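{- Let $\mathcal{V}$ be a coherent variety of semilattice-ordered algebras (in a signature containing at least one constant symbol) that is closed under canonical extensions. Then any unary $\mathcal{V}$-expanding term $t$ that is order-preserving and decreasing in $\mathcal{V}$ (i.e. on each $\mathbf{A}\in\mathcal{V}$: $a\le b$ implies $t(a)\le t(b)$, and $t(a)\le a$) is $n$-potent in $\mathcal{V}$ for some $n\in\mathbb{N}$, i.e. $\mathcal{V}\models t^{n+1}(x)\approx t^n(x)$, where $t^0(x)=x$ and $t^{k+1}(x)=t(t^k(x))$.
   Context: Canonical extensions. A completion of a poset $P$ is a pair $\langle e,C\rangle$ where $C$ is a complete lattice and $e$ is an order embedding of $P$ into $C$ preserving all existing finite meets and joins of $P$. An element of $C$ is open (resp. closed) if it equals $\bigvee e(X)$ (resp. $\bigwedge e(X)$), taken in $C$, for some subset $X$ of $P$; $O$ and $K$ denote the sets of open and closed elements. The completion is dense if every element of $C$ is both a join of closed elements and a meet of open elements; it is compact if for any $A\subseteq K$ and $B\subseteq O$, $\bigwedge A\le\bigvee B$ if and only if there are finite subsets $A_0$ of $A$ and $B_0$ of $B$ with $\bigwedge A_0\le\bigvee B_0$. A dense and compact completion is called a canonical extension; every poset $P$ has one, unique up to a lattice isomorphism commuting with the embeddings, and it is denoted $P^\sigma$, with $P$ identified with its image. For a map $f\colon P\to Q$ between posets, the maps $f^\sigma,f^\pi\colon P^\sigma\to Q^\sigma$ are $$f^\sigma(x)=\bigvee\bigl\{\bigwedge\{f(a)\mid a\in P,\ p\le a\le q\}\mid p\in K,\ q\in O,\ p\le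 x\le q\bigr\},$$ $$f^\pi(x)=\bigwedge\bigl\{\bigvee\{f(a)\mid a\in P,\ p\le a\le q\}\mid p\in K,\ q\in O,\ p\le x\le q\bigr\},$$ where $K$ and $O$ are the sets of closed and open elements of $P^\sigma$. An $n$-ary operation on $P$ is extended by viewing it as a map $P^n\to P$ and identifying $(P^n)^\sigma$ with $(P^\sigma)^n$. A class $\mathcal{C}$ of algebras of a common signature is a class of semilattice-ordered algebras if every member has a (uniformly) term-definable semilattice reduct, which determines its poset reduct, and each operation $o$ in the signature has a canonical extension, $o^\sigma$ or $o^\pi$, determined by $\mathcal{C}$. For $\mathbf{A}\in\mathcal{C}$, $\mathbf{A}^\sigma$ denotes the universe of the canonical extension of the poset reduct of $\mathbf{A}$ equipped with the canonical extensions of the operations of $\mathbf{A}$. $\mathcal{V}$ is closed under canonical extensions if $\mathbf{A}\in\mathcal{V}$ implies $\mathbf{A}^\sigma\in\mathcal{V}$. A term $t$ is $\mathcal{V}$-expanding if $t^{\mathbf{A}^\sigma}\ge(t^{\mathbf{A}})^\sigma$ for all $\mathbf{A}\in\mathcal{V}$ (pointwise), where $t^{\mathbf{A}^\sigma}$ is the term operation evaluated in $\mathbf{A}^\sigma$ and $(t^{\mathbf{A}})^\sigma$ is the $\sigma$-extension of the map $t^{\mathbf{A}}$. $\mathcal{V}$ is coherent if every finitely generated subalgebra of a finitely presented member of $\mathcal{V}$ is finitely presented (finitely presented: isomorphic to a quotient of a finitely generated free algebra of $\mathcal{V}$ by a finitely generated congruence). -}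

module Defs where

open import Level using (Level; Lift) renaming (suc to lsuc)
open import Data.Nat.Base using (ℕ; zero; suc)
open import Data.Fin.Base using (Fin)
open import Data.List.Base using (List; map)
open import Data.List.Relation.Unary.All using (All)
open import Data.List.Relation.Unary.Any using (Any)
open import Data.Product.Base using (Σ-syntax; ∃-syntax; _×_; _,_; proj₁; proj₂)
open import Data.Vec.Functional using (Vector; []; _∷_)
open import Data.Vec.Functional.Relation.Binary.Pointwise using (Pointwise)
import Data.Vec.Functional.Relation.Binary.Pointwise.Properties as Pointwiseₚ
open import Function.Base using (_∘_; flip)
open import Function.Bundles using (_⇔_)
open import Function.Definitions using (Bijective)
open import Relation.Binary.Bundles using (Setoid; Poset)
open import Relation.Binary.Structures using (IsPartialOrder)
open import Relation.Binary.Core using (Rel)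
open import Relation.Binary.Morphism.Structures using (IsOrderMonomorphism)
open import Relation.Binary.PropositionalEquality.Core using (_≡_)
open import Relation.Unary using (Pred; _∈_; _⊆_)
open import Algebra.Lattice.Structures using (IsSemilattice)
import Relation.Binary.Construct.Flip.EqAndOrd as Flip
import Relation.Binary.Construct.NaturalOrder.Left as NaturalOrder

-- Universe convention.  Posets and algebras live in one universe u.  A subset
-- of a poset P is a Pred at level u; "there is a subset of P" is then a
-- proposition at level lsuc u, so subsets of a completion of P are taken at
-- level lsuc u.  Under excluded middle at level lsuc u this is no restriction.

module _ {u : Level} (P : Poset u u u) where
  open Poset P

  IsInf : ∀ {ℓ} → Pred Carrier ℓ → Pred Carrier _
  IsInf S m = (∀ x → x ∈ S → m ≤ x) × (∀ l → (∀ x → x ∈ S → l ≤ x) → l ≤ m)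

  IsSup : ∀ {ℓ} → Pred Carrier ℓ → Pred Carrier _
  IsSup S j = (∀ x → x ∈ S → x ≤ j) × (∀ b → (∀ x → x ∈ S → x ≤ b) → j ≤ b)

  Image : ∀ {ℓ} {X : Set u} → (X → Carrier) → Pred X ℓ → Pred Carrier _
  Image {X = X} e S c = Σ[ a ∈ X ] (a ∈ S × c ≈ e a)

  Listed : List Carrier → Pred Carrier u
  Listed xs c = Any (c ≈_) xs

  _^ᴾ_ : ℕ → Poset u u u
  _^ᴾ_ n = record
    { Carrier        = Vector Carrier n
    ; _≈_            = Pointwise _≈_
    ; _≤_            = Pointwise _≤_
    ; isPartialOrder = record
      { isPreorder = record
        { isEquivalence = Pointwiseₚ.isEquivalence isEquivalence n
        ; reflexive     = λ x≈y i → reflexive (x≈y i)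
        ; trans         = λ x≤y y≤z i → trans (x≤y i) (y≤z i)
        }
      ; antisym = λ x≤y y≤x i → antisym (x≤y i) (y≤x i)
      }
    }

record CompleteLattice (u : Level) : Set (lsuc (lsuc u)) where
  field
    poset : Poset u u u

  open Poset poset public

  field
    ⋁       : Pred Carrier (lsuc u) → Carrier
    ⋀       : Pred Carrier (lsuc u) → Carrier
    ⋁-isSup : ∀ S → IsSup poset S (⋁ S)
    ⋀-isInf : ∀ S → IsInf poset S (⋀ S)

  ⋁ᶠ : List Carrier → Carrier
  ⋁ᶠ xs = ⋁ (Lift (lsuc u) ∘ Listed poset xs)

  ⋀ᶠ : List Carrier → Carrier
  ⋀ᶠ xs = ⋀ (Lift (lsuc u) ∘ Listed poset xs)

  ⋁-cong : ∀ {S T} → (∀ x → x ∈ S → x ∈ T) → (∀ x → x ∈ T → x ∈ S) → ⋁ S ≈ ⋁ T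
  ⋁-cong {S} {T} S⊆T T⊆S = antisym
    (proj₂ (⋁-isSup S) _ λ x x∈S → proj₁ (⋁-isSup T) x (S⊆T x x∈S))
    (proj₂ (⋁-isSup T) _ λ x x∈T → proj₁ (⋁-isSup S) x (T⊆S x x∈T))

  ⋀-cong : ∀ {S T} → (∀ x → x ∈ S → x ∈ T) → (∀ x → x ∈ T → x ∈ S) → ⋀ S ≈ ⋀ T
  ⋀-cong {S} {T} S⊆T T⊆S = antisym
    (proj₂ (⋀-isInf T) _ λ x x∈T → proj₁ (⋀-isInf S) x (T⊆S x x∈T))
    (proj₂ (⋀-isInf S) _ λ x x∈S → proj₁ (⋀-isInf T) x (S⊆T x x∈S))

-- Stated for a bare map e : X → C so as to apply both to an embedding
-- e : P → C and to its power eⁿ : Pⁿ → Cⁿ.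
module _ {u : Level} {X : Set u} (C : Poset u u u) (e : X → Poset.Carrier C) where
  open Poset C

  IsClosed : Pred Carrier (lsuc u)
  IsClosed c = Σ[ S ∈ Pred X u ] IsInf C (Image C e S) c

  IsOpen : Pred Carrier (lsuc u)
  IsOpen c = Σ[ S ∈ Pred X u ] IsSup C (Image C e S) c

record Completion {u : Level} (P : Poset u u u) : Set (lsuc (lsuc u)) where
  private module P = Poset P

  field
    completeLattice : CompleteLattice u

  open CompleteLattice completeLattice public

  field
    e           : P.Carrier → Carrier
    e-embedding : IsOrderMonomorphism P._≈_ _≈_ P._≤_ _≤_ e

    -- the empty list accounts for top and bottom elements of P
    e-meets     : ∀ xs m → IsInf P (Listed P xs) m →
                  IsInf poset (Listed poset (map e xs)) (e m)
    e-joins     : ∀ xs j → IsSup P (Listed P xs) j →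
                  IsSup poset (Listed poset (map e xs)) (e j)

  K O : Pred Carrier (lsuc u)
  K = IsClosed poset e
  O = IsOpen poset e

  Dense : Set (lsuc (lsuc u))
  Dense = ∀ x →
    (Σ[ S ∈ Pred Carrier (lsuc u) ] (S ⊆ K × x ≈ ⋁ S)) ×
    (Σ[ S ∈ Pred Carrier (lsuc u) ] (S ⊆ O × x ≈ ⋀ S))

  Compact : Set (lsuc (lsuc u))
  Compact = ∀ (A B : Pred Carrier (lsuc u)) → A ⊆ K → B ⊆ O →
    ⋀ A ≤ ⋁ B ⇔ (∃[ A₀ ] ∃[ B₀ ] (All A A₀ × All B B₀ × ⋀ᶠ A₀ ≤ ⋁ᶠ B₀))

record CanonicalExtension {u : Level} (P : Poset u u u) : Set (lsuc (lsuc u)) where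
  field
    completion : Completion P

  open Completion completion public

  field
    dense   : Dense
    compact : Compact

module _ {u : Level} {X Y : Set u}
         (C : Poset u u u) (e : X → Poset.Carrier C)
         (D : CompleteLattice u) (d : Y → CompleteLattice.Carrier D)
         (f : X → Y) where
  private
    module C = Poset C
    module D = CompleteLattice D

  ImageOfInterval : C.Carrier → C.Carrier → Pred D.Carrier (lsuc u)
  ImageOfInterval p q =
    Image D.poset (d ∘ f) (λ a → Lift (lsuc u) (p C.≤ e a × e a C.≤ q))

  σ-extension : C.Carrier → D.Carrier
  σ-extension x = D.⋁ λ y → ∃[ p ] ∃[ q ]
    (IsClosed C e p × IsOpen C e q × p C.≤ x × x C.≤ q × y D.≈ D.⋀ (ImageOfInterval p q))

  π-extension : C.Carrier → D.Carrier
  π-extension x = D.⋀ λ y → ∃[ p ] ∃[ q ]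
    (IsClosed C e p × IsOpen C e q × p C.≤ x × x C.≤ q × y D.≈ D.⋁ (ImageOfInterval p q))

  σ-extension-cong : ∀ {x x′} → x C.≈ x′ → σ-extension x D.≈ σ-extension x′
  σ-extension-cong x≈x′ = D.⋁-cong
    (λ { y (p , q , cp , oq , p≤x , x≤q , eq) → p , q , cp , oq ,
         C.≤-respʳ-≈ x≈x′ p≤x , C.≤-respˡ-≈ x≈x′ x≤q , eq })
    (λ { y (p , q , cp , oq , p≤x , x≤q , eq) → p , q , cp , oq ,
         C.≤-respʳ-≈ (C.Eq.sym x≈x′) p≤x , C.≤-respˡ-≈ (C.Eq.sym x≈x′) x≤q , eq })

  π-extension-cong : ∀ {x x′} → x C.≈ x′ → π-extension x D.≈ π-extension x′
  π-extension-cong x≈x′ = D.⋀-cong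
    (λ { y (p , q , cp , oq , p≤x , x≤q , eq) → p , q , cp , oq ,
         C.≤-respʳ-≈ x≈x′ p≤x , C.≤-respˡ-≈ x≈x′ x≤q , eq })
    (λ { y (p , q , cp , oq , p≤x , x≤q , eq) → p , q , cp , oq ,
         C.≤-respʳ-≈ (C.Eq.sym x≈x′) p≤x , C.≤-respˡ-≈ (C.Eq.sym x≈x′) x≤q , eq })

record Signature (u : Level) : Set (lsuc u) where
  field
    Op    : Set u
    arity : Op → ℕ

record Algebra {u : Level} (S : Signature u) : Set (lsuc u) where
  open Signature S
  field
    setoid : Setoid u u

  open Setoid setoid public

  field
    op      : ∀ o → Vector Carrier (arity o) → Carrier
    op-cong : ∀ o {as bs} → Pointwise _≈_ as bs → op o as ≈ op o bs

data Term {u : Level} (S : Signature u) (X : Set) : Set u where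
  var : X → Term S X
  app : ∀ o → Vector (Term S X) (Signature.arity S o) → Term S X

module _ {u : Level} {S : Signature u} where

  _[_] : ∀ {X Y} → Term S X → (X → Term S Y) → Term S Y
  var x    [ θ ] = θ x
  app o ts [ θ ] = app o (λ i → ts i [ θ ])

  eval : ∀ (A : Algebra S) {X} → Term S X → (X → Algebra.Carrier A) → Algebra.Carrier A
  eval A (var x)    ρ = ρ x
  eval A (app o ts) ρ = Algebra.op A o (λ i → eval A (ts i) ρ)

  _⊨_≋_ : ∀ (A : Algebra S) {X} → Term S X → Term S X → Set u
  A ⊨ s ≋ t = ∀ ρ → Algebra._≈_ A (eval A s ρ) (eval A t ρ)

  unary : ∀ (A : Algebra S) → Term S (Fin 1) → Algebra.Carrier A → Algebra.Carrier A
  unary A t a = eval A t (a ∷ [])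

  binary : ∀ (A : Algebra S) → Term S (Fin 2) →
           Algebra.Carrier A → Algebra.Carrier A → Algebra.Carrier A
  binary A t a b = eval A t (a ∷ b ∷ [])

  _^_ : Term S (Fin 1) → ℕ → Term S (Fin 1)
  t ^ zero  = var Fin.zero
  t ^ suc k = t [ (λ _ → t ^ k) ]

record _≅_ {u : Level} {S : Signature u} (A B : Algebra S) : Set u where
  private
    module A = Algebra A
    module B = Algebra B
  field
    to        : A.Carrier → B.Carrier
    to-cong   : ∀ {x y} → x A.≈ y → to x B.≈ to y
    to-op     : ∀ o as → to (A.op o as) B.≈ B.op o (to ∘ as)
    bijective : Bijective A._≈_ B._≈_ to

module _ {u : Level} {S : Signature u} (A : Algebra S) where
  open Algebra A

  data GeneratedCongruence (R : List (Carrier × Carrier)) : Rel Carrier u where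
    base  : ∀ {x y} → Any ((x , y) ≡_) R → GeneratedCongruence R x y
    reflᶜ : ∀ {x y} → x ≈ y → GeneratedCongruence R x y
    symᶜ  : ∀ {x y} → GeneratedCongruence R x y → GeneratedCongruence R y x
    trnᶜ  : ∀ {x y z} → GeneratedCongruence R x y → GeneratedCongruence R y z →
            GeneratedCongruence R x z
    opᶜ   : ∀ o {as bs} → Pointwise (GeneratedCongruence R) as bs →
            GeneratedCongruence R (op o as) (op o bs)

  _/⟨_⟩ : List (Carrier × Carrier) → Algebra S
  _/⟨_⟩ R = record
    { setoid  = record
      { Carrier       = Carrier
      ; _≈_           = GeneratedCongruence R
      ; isEquivalence = record { refl = reflᶜ refl ; sym = symᶜ ; trans = trnᶜ }
      }
    ; op      = op
    ; op-cong = opᶜ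
    }

  data Generated {k : ℕ} (g : Vector Carrier k) : Pred Carrier u where
    gen  : ∀ i → Generated g (g i)
    opᵍ  : ∀ o {as} → (∀ i → Generated g (as i)) → Generated g (op o as)
    resp : ∀ {x y} → x ≈ y → Generated g x → Generated g y

  Subalgebra⟨_⟩ : ∀ {k} → Vector Carrier k → Algebra S
  Subalgebra⟨_⟩ g = record
    { setoid  = record
      { Carrier       = Σ[ x ∈ Carrier ] Generated g x
      ; _≈_           = λ x y → proj₁ x ≈ proj₁ y
      ; isEquivalence = record { refl = refl ; sym = sym ; trans = trans }
      }
    ; op      = λ o as → op o (proj₁ ∘ as) , opᵍ o (proj₂ ∘ as)
    ; op-cong = λ o → op-cong o
    }

-- A variety is given by a set of identities in countably many variables.
record Variety (u : Level) : Set (lsuc u) where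
  field
    signature : Signature u
    Identity  : Rel (Term signature ℕ) u

  Model : Algebra signature → Set u
  Model A = ∀ {l r} → Identity l r → A ⊨ l ≋ r

  Satisfies : ∀ {X} → Term signature X → Term signature X → Set (lsuc u)
  Satisfies s t = ∀ A → Model A → A ⊨ s ≋ t

  data Derivable (n : ℕ) : Rel (Term signature (Fin n)) u where
    instanceᵈ : ∀ {l r} → Identity l r → ∀ (θ : ℕ → Term signature (Fin n)) →
                Derivable n (l [ θ ]) (r [ θ ])
    reflᵈ     : ∀ {s} → Derivable n s s
    symᵈ      : ∀ {s t} → Derivable n s t → Derivable n t s
    trnᵈ      : ∀ {s t v} → Derivable n s t → Derivable n t v → Derivable n s v
    appᵈ      : ∀ o {ss ts} → Pointwise (Derivable n) ss ts →
                Derivable n (app o ss) (app o ts)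

  Free : ℕ → Algebra signature
  Free n = record
    { setoid  = record
      { Carrier       = Term signature (Fin n)
      ; _≈_           = Derivable n
      ; isEquivalence = record { refl = reflᵈ ; sym = symᵈ ; trans = trnᵈ }
      }
    ; op      = app
    ; op-cong = appᵈ
    }

  FinitelyPresented : Algebra signature → Set u
  FinitelyPresented A = ∃[ n ] ∃[ R ] (A ≅ (Free n /⟨ R ⟩))

  Coherent : Set (lsuc u)
  Coherent = ∀ B → Model B → FinitelyPresented B →
             ∀ {k} (g : Vector (Algebra.Carrier B) k) →
             FinitelyPresented (Subalgebra⟨_⟩ B g)

data SemilatticeKind : Set where
  meet join : SemilatticeKind

data ExtensionKind : Set where
  σ π : ExtensionKind

record SemilatticeOrderedVariety (u : Level) : Set (lsuc u) where
  field
    variety : Variety u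

  open Variety variety public
  open Signature signature public

  field
    semilatticeTerm : Term signature (Fin 2)
    isSemilattice   : ∀ A → Model A →
                      IsSemilattice (Algebra._≈_ A) (binary A semilatticeTerm)
    semilatticeKind : SemilatticeKind
    extensionKind   : Op → ExtensionKind

  HasConstant : Set u
  HasConstant = ∃[ o ] (arity o ≡ 0)

  module Natural (A : Algebra signature) =
    NaturalOrder (Algebra._≈_ A) (binary A semilatticeTerm)

  -- x ≤ y iff x ≈ x ∙ y (meet), respectively y ≈ y ∙ x (join)
  Order : SemilatticeKind → ∀ A → Rel (Algebra.Carrier A) u
  Order meet A = Natural._≤_ A
  Order join A = flip (Natural._≤_ A)

  isPartialOrder : ∀ s A → Model A → IsPartialOrder (Algebra._≈_ A) (Order s A)
  isPartialOrder meet A A∈V = Natural.isPartialOrder A (isSemilattice A A∈V)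
  isPartialOrder join A A∈V =
    Flip.isPartialOrder (Natural.isPartialOrder A (isSemilattice A A∈V))

  reduct : ∀ A → Model A → Poset u u u
  reduct A A∈V = record { isPartialOrder = isPartialOrder semilatticeKind A A∈V }

  -- An n-ary operation is extended as a map Aⁿ → A, with Cⁿ as completion of Aⁿ.
  module _ (A : Algebra signature) (A∈V : Model A)
           (C : CanonicalExtension (reduct A A∈V)) where
    private module C = CanonicalExtension C

    extend : ExtensionKind → ∀ o → Vector C.Carrier (arity o) → C.Carrier
    extend σ o = σ-extension (C.poset ^ᴾ arity o) (C.e ∘_) C.completeLattice C.e (Algebra.op A o)
    extend π o = π-extension (C.poset ^ᴾ arity o) (C.e ∘_) C.completeLattice C.e (Algebra.op A o)

    extend-cong : ∀ s o {x y} → Pointwise C._≈_ x y → extend s o x C.≈ extend s o y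
    extend-cong σ o =
      σ-extension-cong (C.poset ^ᴾ arity o) (C.e ∘_) C.completeLattice C.e (Algebra.op A o)
    extend-cong π o =
      π-extension-cong (C.poset ^ᴾ arity o) (C.e ∘_) C.completeLattice C.e (Algebra.op A o)

    canonicalAlgebra : Algebra signature
    canonicalAlgebra = record
      { setoid  = Poset.Eq.setoid C.poset
      ; op      = λ o → extend (extensionKind o) o
      ; op-cong = λ o → extend-cong (extensionKind o) o
      }

  -- A^σ is determined up to isomorphism only, so C ranges over all canonical
  -- extensions.  A^σ belongs to V as an ordered algebra: the lattice order of C,
  -- which is its poset reduct, is the order given by its semilattice reduct.
  ClosedUnderCanonicalExtensions : Set (lsuc (lsuc u))
  ClosedUnderCanonicalExtensions =
    ∀ A (A∈V : Model A) (C : CanonicalExtension (reduct A A∈V)) →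
    let Aσ = canonicalAlgebra A A∈V C in
    Σ[ Aσ∈V ∈ Model Aσ ]
      (∀ x y → CanonicalExtension._≤_ C x y ⇔ Poset._≤_ (reduct Aσ Aσ∈V) x y)

  Expanding : Term signature (Fin 1) → Set (lsuc (lsuc u))
  Expanding t =
    ∀ A (A∈V : Model A) (C : CanonicalExtension (reduct A A∈V)) →
    let open CanonicalExtension C in
    ∀ x → σ-extension poset e completeLattice e (unary A t) x
          ≤ unary (canonicalAlgebra A A∈V C) t x

  OrderPreserving : Term signature (Fin 1) → Set (lsuc u)
  OrderPreserving t = ∀ A (A∈V : Model A) → let open Poset (reduct A A∈V) in
    ∀ a b → a ≤ b → unary A t a ≤ unary A t b

  Decreasing : Term signature (Fin 1) → Set (lsuc u)
  Decreasing t = ∀ A (A∈V : Model A) → let open Poset (reduct A A∈V) in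
    ∀ a → unary A t a ≤ a

{-# OPTIONS --safe #-}

-- Let B ∈ V be presented by x, y, z with y ≤ z ≤ x and z ≤ t(z).  In B we have
-- y ≤ tᵏ(x) for every k.  Conversely, an equation between x and y that holds in
-- B holds in every A ∈ V in which y ≤ tᵏ(x) for all k: in A^σ one can take
-- z = ⋀ tᵏ(x), since compactness gives z ≤ (t^A)^σ(z), which is below t(z) as t
-- is expanding.  By coherence the equations of the subalgebra ⟨x, y⟩ of B follow
-- from finitely many of them, so already from y ≤ tⁿ(x) for a single n.  Hence
-- y ≤ tⁿ(x) entails y ≤ tⁿ⁺¹(x), and y = tⁿ(x) gives the claim.
--
-- The canonical extension of a poset is the concept lattice of the relation
-- F ∩ I ≠ ∅ between its filters F and ideals I.

module Submission where

open import Level using (Level; Lift; lift; lower) renaming (suc to lsuc)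
open import Data.Bool.Base using (Bool; T)
open import Data.Nat.Base using (ℕ; zero; suc; _⊔_; _≤′_; ≤′-refl; ≤′-step)
  renaming (_≤_ to _≤ⁿ_)
import Data.Nat.Properties as ℕ
open import Data.Fin.Base using (Fin; zero; suc)
open import Data.List.Base using (List; []; _∷_; map; _++_; tabulate)
open import Data.List.Relation.Unary.All as All using (All; []; _∷_)
import Data.List.Relation.Unary.All.Properties as Allₚ
open import Data.List.Relation.Unary.Any using (here; there)
open import Data.Product.Base using (∃-syntax; _×_; _,_; proj₁; proj₂)
open import Data.Vec.Functional as Vector using (Vector)
open import Function.Base using (_∘_; case_of_; id)
open import Function.Bundles using (mk⇔; Equivalence)
open import Relation.Binary.Bundles using (Poset)
import Relation.Binary.Construct.Flip.EqAndOrd as Flip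
open import Relation.Binary.Morphism.Structures using (IsOrderMonomorphism)
open import Relation.Binary.PropositionalEquality.Core using (_≡_) renaming (refl to ≡-refl)
import Relation.Binary.Reasoning.Setoid as ≈-Reasoning
open import Relation.Nullary.Decidable.Core using (isYes; toWitness; fromWitness)
open import Relation.Unary using (Pred; _∈_; _⊆_)
open import Axiom.ExcludedMiddle using (ExcludedMiddle)
open import Defs

-- Subsets that must form a type at level u are Boolean-valued; excluded middle
-- turns every predicate into one.
record ⟦_⟧ {u : Level} {X : Set u} (f : X → Bool) (x : X) : Set u where
  constructor holds
  field isTrue : T (f x)

module _ {u : Level} (em : ExcludedMiddle (lsuc u)) {X : Set u} (Φ : Pred X (lsuc u)) where

  decide : X → Bool
  decide x = isYes (em {Φ x})

  decide⁺ : Φ ⊆ ⟦ decide ⟧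
  decide⁺ {x} φ = holds (fromWitness {a? = em {Φ x}} φ)

  decide⁻ : ⟦ decide ⟧ ⊆ Φ
  decide⁻ {x} (holds h) = toWitness {a? = em {Φ x}} h

-- Complete lattices and their finite meets.

dual : ∀ {u} → CompleteLattice u → CompleteLattice u
dual L = record
  { poset   = Flip.poset poset
  ; ⋁       = ⋀
  ; ⋀       = ⋁
  ; ⋁-isSup = ⋀-isInf
  ; ⋀-isInf = ⋁-isSup
  }
  where open CompleteLattice L

module CompleteLatticeProperties {u : Level} (L : CompleteLattice u) where
  open CompleteLattice L

  ⋀-lower : ∀ S {x} → x ∈ S → ⋀ S ≤ x
  ⋀-lower S = proj₁ (⋀-isInf S) _

  ⋀-greatest : ∀ S {l} → (∀ x → x ∈ S → l ≤ x) → l ≤ ⋀ S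
  ⋀-greatest S = proj₂ (⋀-isInf S) _

  ⋁-upper : ∀ S {x} → x ∈ S → x ≤ ⋁ S
  ⋁-upper S = proj₁ (⋁-isSup S) _

  ⋁-least : ∀ S {b} → (∀ x → x ∈ S → x ≤ b) → ⋁ S ≤ b
  ⋁-least S = proj₂ (⋁-isSup S) _

  ⋀ᶠ-lower : ∀ {xs} → All (⋀ᶠ xs ≤_) xs
  ⋀ᶠ-lower {xs} = All.tabulateₛ Eq.setoid (⋀-lower _ ∘ lift)

  ⋀ᶠ-greatest : ∀ {l xs} → All (l ≤_) xs → l ≤ ⋀ᶠ xs
  ⋀ᶠ-greatest {l} {xs} l≤xs = ⋀-greatest _ λ { x (lift x∈xs) → below l≤xs x∈xs }
    where
    below : ∀ {x xs} → All (l ≤_) xs → Listed poset xs x → l ≤ x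
    below (l≤y ∷ _) (here x≈y) = ≤-respʳ-≈ (Eq.sym x≈y) l≤y
    below (_ ∷ l≤ys) (there x∈) = below l≤ys x∈

-- The concept lattice of a relation.

module Polarity {u : Level} (em : ExcludedMiddle (lsuc u))
                {X Y : Set u} (_R_ : X → Y → Set u) where

  -- A concept is represented by any set of attributes generating its intent.
  Concept : Set u
  Concept = Y → Bool

  record Extent (v : Concept) (x : X) : Set u where
    constructor extent
    field related : ∀ {y} → y ∈ ⟦ v ⟧ → x R y

  record _⊑_ (v w : Concept) : Set u where
    constructor ⊑-intro
    field ⊑-elim : Extent v ⊆ Extent w

  open Extent public
  open _⊑_ public

  -- The attributes of a meet: an object has all of them exactly when it lies in every extent, so
  -- extents of meets are intersections.
  Conjoined : Pred Concept (lsuc u) → Pred Y (lsuc u)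
  Conjoined S y = ∃[ v ] (v ∈ S × y ∈ ⟦ v ⟧)

  -- The attributes of a join: their extent is the Galois closure of the union of the extents.
  Shared : Pred Concept (lsuc u) → Pred Y (lsuc u)
  Shared S y = ∀ v → v ∈ S → ∀ x → x ∈ Extent v → x R y

  ⊑-trans : ∀ {v w z} → v ⊑ w → w ⊑ z → v ⊑ z
  ⊑-trans v⊑w w⊑z = ⊑-intro (⊑-elim w⊑z ∘ ⊑-elim v⊑w)

  conceptLattice : CompleteLattice u
  conceptLattice = record
    { poset = record
      { Carrier = Concept
      ; _≈_     = λ v w → v ⊑ w × w ⊑ v
      ; _≤_     = _⊑_
      ; isPartialOrder = record
        { isPreorder = record
          { isEquivalence = record
            { refl  = ⊑-intro (λ x∈ → x∈) , ⊑-intro (λ x∈ → x∈)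
            ; sym   = λ (v≤w , w≤v) → w≤v , v≤w
            ; trans = λ (v≤w , w≤v) (w≤z , z≤w) → ⊑-trans v≤w w≤z , ⊑-trans z≤w w≤v
            }
          ; reflexive = proj₁
          ; trans     = ⊑-trans
          }
        ; antisym = _,_
        }
      }
    ; ⋁ = λ S → decide em (Shared S)
    ; ⋀ = λ S → decide em (Conjoined S)
    ; ⋁-isSup = λ S →
        (λ v v∈S → ⊑-intro λ x∈v → extent λ y∈ → decide⁻ em (Shared S) y∈ v v∈S _ x∈v) ,
        (λ w S≤w → ⊑-intro λ x∈ → extent λ y∈w → related x∈
           (decide⁺ em (Shared S) λ v v∈S x x∈v → related (⊑-elim (S≤w v v∈S) x∈v) y∈w))
    ; ⋀-isInf = λ S →
        (λ v v∈S → ⊑-intro λ x∈ → extent λ y∈v →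
           related x∈ (decide⁺ em (Conjoined S) (v , v∈S , y∈v))) ,
        (λ w w≤S → ⊑-intro λ x∈w → extent λ y∈ →
           let v , v∈S , y∈v = decide⁻ em (Conjoined S) y∈
           in related (⊑-elim (w≤S v v∈S) x∈w) y∈v)
    }

  module _ (y : Y) where

    private
      Singleton : Pred Y (lsuc u)
      Singleton z = Lift (lsuc u) (z ≡ y)

    attribute : Concept
    attribute = decide em Singleton

    attribute⁺ : (_R y) ⊆ Extent attribute
    attribute⁺ xRy = extent λ z∈ → case decide⁻ em Singleton z∈ of λ where (lift ≡-refl) → xRy

    attribute⁻ : Extent attribute ⊆ (_R y)
    attribute⁻ x∈ = related x∈ (decide⁺ em Singleton (lift ≡-refl))

-- Filters of a poset; ideals are filters of the opposite poset.

-- No directedness is required: closure under the existing finite meets is what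
-- makes the completion preserve them.
record Filter {u : Level} (P : Poset u u u) : Set u where
  open Poset P
  field
    member   : Carrier → Bool
    up       : ∀ {a b} → a ≤ b → a ∈ ⟦ member ⟧ → b ∈ ⟦ member ⟧
    inf      : ∀ {xs m} → IsInf P (Listed P xs) m → All ⟦ member ⟧ xs → m ∈ ⟦ member ⟧

module _ {u : Level} (P : Poset u u u) where
  open Poset P

  data Generatedꟳ (Φ : Pred Carrier (lsuc u)) : Pred Carrier (lsuc u) where
    gen : ∀ {a} → a ∈ Φ → Generatedꟳ Φ a
    up  : ∀ {a b} → a ≤ b → Generatedꟳ Φ a → Generatedꟳ Φ b
    inf : ∀ {xs m} → IsInf P (Listed P xs) m → All (Generatedꟳ Φ) xs → Generatedꟳ Φ m

  module _ (em : ExcludedMiddle (lsuc u)) where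

    generatedFilter : Pred Carrier (lsuc u) → Filter P
    generatedFilter Φ = record
      { member = decide em (Generatedꟳ Φ)
      ; up     = λ a≤b a∈ → decide⁺ em (Generatedꟳ Φ) (up a≤b (decide⁻ em (Generatedꟳ Φ) a∈))
      ; inf    = λ m-inf xs∈ →
          decide⁺ em (Generatedꟳ Φ) (inf m-inf (All.map (decide⁻ em (Generatedꟳ Φ)) xs∈))
      }

    module _ (a : Carrier) where
      private
        Above : Pred Carrier (lsuc u)
        Above b = Lift (lsuc u) (a ≤ b)

        above-listed : ∀ {xs x} → All ⟦ decide em Above ⟧ xs → Listed P xs x → a ≤ x
        above-listed (y∈ ∷ _) (here x≈y) = ≤-respʳ-≈ (Eq.sym x≈y) (lower (decide⁻ em Above y∈))
        above-listed (_ ∷ ys∈) (there x∈) = above-listed ys∈ x∈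

      ∈-principal⁺ : ∀ {b} → a ≤ b → b ∈ ⟦ decide em Above ⟧
      ∈-principal⁺ a≤b = decide⁺ em Above (lift a≤b)

      ∈-principal⁻ : ∀ {b} → b ∈ ⟦ decide em Above ⟧ → a ≤ b
      ∈-principal⁻ b∈ = lower (decide⁻ em Above b∈)

      principalFilter : Filter P
      principalFilter = record
        { member = decide em Above
        ; up     = λ b≤c b∈ → ∈-principal⁺ (trans (∈-principal⁻ b∈) b≤c)
        ; inf    = λ (_ , greatest) xs∈ → ∈-principal⁺ (greatest a λ x → above-listed xs∈)
        }

-- Existence of canonical extensions.

module _ {u : Level} (P : Poset u u u) (L : CompleteLattice u) where
  private module P = Poset P
  open CompleteLattice L
  open CompleteLatticeProperties L

  module _ (e : P.Carrier → Carrier) (e-mono : ∀ {a b} → a P.≤ b → e a ≤ e b)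
           (e-meets : ∀ xs m → IsInf P (Listed P xs) m →
                      IsInf poset (Listed poset (map e xs)) (e m))
           (A : Pred Carrier (lsuc u)) where

    private
      FinitelyAbove : Pred P.Carrier (lsuc u)
      FinitelyAbove a = ∃[ A₀ ] (All A A₀ × ⋀ᶠ A₀ ≤ e a)

    -- Induction on the generation. In the case `inf` the finite lists for the elements of `xs` are
    -- concatenated, and `e-meets` puts the resulting meet below `e m`. With the opposite poset and
    -- the dual lattice it yields the fact about ideals.
    generated-finitely : Generatedꟳ P (λ a → ∃[ c ] (c ∈ A × c ≤ e a)) ⊆ FinitelyAbove
    all-generated-finitely : ∀ {xs} →
      All (Generatedꟳ P (λ a → ∃[ c ] (c ∈ A × c ≤ e a))) xs →
      ∃[ A₀ ] (All A A₀ × (∀ x → Listed poset (map e xs) x → ⋀ᶠ A₀ ≤ x))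

    generated-finitely (gen (c , c∈A , c≤ea)) =
      c ∷ [] , c∈A ∷ [] , trans (All.head ⋀ᶠ-lower) c≤ea
    generated-finitely (up a≤b a∈) =
      let A₀ , A₀⊆A , A₀≤ea = generated-finitely a∈ in A₀ , A₀⊆A , trans A₀≤ea (e-mono a≤b)
    generated-finitely (inf m-inf xs∈) =
      let A₀ , A₀⊆A , A₀≤ = all-generated-finitely xs∈
      in A₀ , A₀⊆A , proj₂ (e-meets _ _ m-inf) _ A₀≤

    all-generated-finitely [] = [] , [] , λ _ ()
    all-generated-finitely (x∈ ∷ xs∈) =
      let A₁ , A₁⊆A , A₁≤ = generated-finitely x∈
          A₂ , A₂⊆A , A₂≤ = all-generated-finitely xs∈
          bound = ⋀ᶠ-lower {A₁ ++ A₂}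
      in A₁ ++ A₂ , Allₚ.++⁺ A₁⊆A A₂⊆A , λ where
           y (here y≈ex) → ≤-respʳ-≈ (Eq.sym y≈ex)
                             (trans (⋀ᶠ-greatest (Allₚ.++⁻ˡ A₁ bound)) A₁≤)
           y (there y∈)  → trans (⋀ᶠ-greatest (Allₚ.++⁻ʳ A₁ bound)) (A₂≤ y y∈)

module CanonicalExtensionOf {u : Level} (em : ExcludedMiddle (lsuc u)) (P : Poset u u u) where
  private
    module P = Poset P
    Pᵒᵖ = Flip.poset P

  Ideal : Set u
  Ideal = Filter Pᵒᵖ

  _∈ꟳ_ : P.Carrier → Filter P → Set u
  a ∈ꟳ F = a ∈ ⟦ Filter.member F ⟧

  _∈ᴵ_ : P.Carrier → Ideal → Set u
  a ∈ᴵ I = a ∈ ⟦ Filter.member I ⟧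

  _≬_ : Filter P → Ideal → Set u
  F ≬ I = ∃[ a ] (a ∈ꟳ F × a ∈ᴵ I)

  ↑ : P.Carrier → Filter P
  ↑ a = principalFilter P em a

  ↓ : P.Carrier → Ideal
  ↓ a = principalFilter Pᵒᵖ em a

  ∈-↑ : ∀ {a b} → a P.≤ b → b ∈ꟳ ↑ a
  ∈-↑ = ∈-principal⁺ P em _

  ∈-↑⁻ : ∀ {a b} → b ∈ꟳ ↑ a → a P.≤ b
  ∈-↑⁻ = ∈-principal⁻ P em _

  ∈-↓ : ∀ {a b} → b P.≤ a → b ∈ᴵ ↓ a
  ∈-↓ = ∈-principal⁺ Pᵒᵖ em _

  ∈-↓⁻ : ∀ {a b} → b ∈ᴵ ↓ a → b P.≤ a
  ∈-↓⁻ = ∈-principal⁻ Pᵒᵖ em _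

  open Polarity em _≬_
  open CompleteLattice conceptLattice
  open CompleteLatticeProperties conceptLattice

  -- A filter meets `↓ a` exactly when it contains `a`, so the extent of `e a` is the set of filters
  -- containing `a`.
  e : P.Carrier → Concept
  e a = attribute (↓ a)

  e⁺ : ∀ a F → a ∈ꟳ F → F ∈ Extent (e a)
  e⁺ a F a∈F = attribute⁺ (↓ a) (a , a∈F , ∈-↓ P.refl)

  e⁻ : ∀ a F → F ∈ Extent (e a) → a ∈ꟳ F
  e⁻ a F F∈ = let b , b∈F , b∈↓a = attribute⁻ (↓ a) F∈
              in Filter.up F (∈-↓⁻ b∈↓a) b∈F

  e-mono : ∀ {a b} → a P.≤ b → e a ≤ e b
  e-mono a≤b = ⊑-intro λ {F} F∈ → e⁺ _ F (Filter.up F a≤b (e⁻ _ F F∈))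

  e-cancel : ∀ {a b} → e a ≤ e b → a P.≤ b
  e-cancel {a} {b} ea≤eb = ∈-↑⁻ (e⁻ b (↑ a) (⊑-elim ea≤eb (e⁺ a (↑ a) (∈-↑ P.refl))))

  below-ideal : ∀ a I → e a ≤ attribute I → a ∈ᴵ I
  below-ideal a I ea≤I =
    let b , b∈↑a , b∈I = attribute⁻ I (⊑-elim ea≤I (e⁺ a (↑ a) (∈-↑ P.refl)))
    in Filter.up I (∈-↑⁻ b∈↑a) b∈I

  member-≤-attribute : ∀ {a I} → a ∈ᴵ I → e a ≤ attribute I
  member-≤-attribute {a} {I} a∈I = ⊑-intro λ {F} F∈ → attribute⁺ I (a , e⁻ a F F∈ , a∈I)

  -- A filter in the extent of `attribute I` shares some `a` with `I`, so it lies in the extent of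
  -- `e a`. With `member-≤-attribute` this makes `attribute I` a join of images, hence open.
  above-members : ∀ {I v} → (∀ a → a ∈ᴵ I → e a ≤ v) → attribute I ≤ v
  above-members {I} I≤v = ⊑-intro λ {F} F∈ →
    let a , a∈F , a∈I = attribute⁻ I F∈ in ⊑-elim (I≤v a a∈I) (e⁺ a F a∈F)

  ≤-attribute : ∀ {v I} → I ∈ ⟦ v ⟧ → v ≤ attribute I
  ≤-attribute {I = I} I∈v = ⊑-intro λ F∈ → attribute⁺ I (related F∈ I∈v)

  listed-map⁺ : ∀ {Q : Pred P.Carrier u} xs →
                (∀ a → Listed poset (map e xs) (e a) → Q a) → All Q xs
  listed-map⁺ []       h = []
  listed-map⁺ (x ∷ xs) h = h x (here Eq.refl) ∷ listed-map⁺ xs λ a → h a ∘ there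

  listed-map⁻ : ∀ xs {v} → Listed poset (map e xs) v → ∃[ a ] (Listed P xs a × v ≈ e a)
  listed-map⁻ (x ∷ xs) (here v≈ex) = x , here P.Eq.refl , v≈ex
  listed-map⁻ (x ∷ xs) (there v∈)  =
    let a , a∈xs , v≈ea = listed-map⁻ xs v∈ in a , there a∈xs , v≈ea

  completion : Completion P
  completion = record
    { completeLattice = conceptLattice
    ; e = e
    ; e-embedding = record
      { isOrderHomomorphism = record
        { cong = λ a≈b → e-mono (P.reflexive a≈b) , e-mono (P.reflexive (P.Eq.sym a≈b))
        ; mono = e-mono
        }
      ; injective = λ (ea≤eb , eb≤ea) → P.antisym (e-cancel ea≤eb) (e-cancel eb≤ea)
      ; cancel = e-cancel
      }
    ; e-meets = λ xs m m-inf →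
        (λ v v∈ → let a , a∈xs , v≈ea = listed-map⁻ xs v∈
                  in ≤-respʳ-≈ (Eq.sym v≈ea) (e-mono (proj₁ m-inf a a∈xs))) ,
        λ v v≤ → ⊑-intro λ {F} F∈ → e⁺ m F (Filter.inf F m-inf
          (listed-map⁺ xs λ a ea∈ → e⁻ a F (⊑-elim (v≤ (e a) ea∈) F∈)))
    ; e-joins = λ xs j j-sup →
        (λ v v∈ → let a , a∈xs , v≈ea = listed-map⁻ xs v∈
                  in ≤-respˡ-≈ (Eq.sym v≈ea) (e-mono (proj₁ j-sup a a∈xs))) ,
        -- An attribute `I` of the upper bound `v` contains all of `xs` and hence `j`, so `j`
        -- witnesses that `F` meets `I`.
        λ v ≤v → ⊑-intro λ {F} F∈ → extent λ {I} I∈v → j , e⁻ j F F∈ , Filter.inf I j-sup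
          (listed-map⁺ xs λ a ea∈ → below-ideal a I (trans (≤v (e a) ea∈) (≤-attribute I∈v)))
    }

  open Completion completion using (K; O; Dense; Compact; e-meets; e-joins)

  Members : Filter P → Pred Concept (lsuc u)
  Members F = Lift (lsuc u) ∘ Image poset e (_∈ꟳ F)

  ⋀-Members-closed : ∀ F → ⋀ (Members F) ∈ K
  ⋀-Members-closed F = (_∈ꟳ F) ,
    (λ v v∈ → ⋀-lower (Members F) (lift v∈)) ,
    (λ l l≤ → ⋀-greatest (Members F) λ v (lift v∈) → l≤ v v∈)

  attribute-open : ∀ I → attribute I ∈ O
  attribute-open I = (_∈ᴵ I) ,
    (λ v (a , a∈I , v≈ea) → ≤-respˡ-≈ (Eq.sym v≈ea) (member-≤-attribute a∈I)) ,
    (λ w ≤w → above-members λ a a∈I → ≤w (e a) (a , a∈I , Eq.refl))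

  ∈-Extent-⋀ : ∀ S F → (∀ v → v ∈ S → F ∈ Extent v) → F ∈ Extent (⋀ S)
  ∈-Extent-⋀ S F F∈ = extent λ I∈ →
    let v , v∈S , I∈v = decide⁻ em (Conjoined S) I∈ in related (F∈ v v∈S) I∈v

  -- Each filter `F` in the extent of `v` gives the closed element `⋀ (Members F)`, which lies below
  -- `v` and has `F` in its extent. Each attribute `I` of `v` gives the open element `attribute I`
  -- above `v`.
  dense : Dense
  dense v = (Closed , proj₁ , antisym v≤⋁ (⋁-least Closed λ c → proj₂)) ,
            (Open , proj₁ , antisym (⋀-greatest Open (λ c → proj₂)) ⋀≤v)
    where
    Closed Open : Pred Concept (lsuc u)
    Closed c = c ∈ K × c ≤ v
    Open c = c ∈ O × v ≤ c

    v≤⋁ : v ≤ ⋁ Closed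
    v≤⋁ = ⊑-intro λ {F} F∈v →
      let ⋀F≤v = ⊑-intro λ {G} G∈ → extent λ I∈v →
            let a , a∈F , a∈I = related F∈v I∈v
            in a , e⁻ a G (⊑-elim (⋀-lower (Members F) (lift (a , a∈F , Eq.refl))) G∈) , a∈I
      in ⊑-elim (⋁-upper Closed (⋀-Members-closed F , ⋀F≤v))
           (∈-Extent-⋀ (Members F) F λ { w (lift (a , a∈F , w≈ea)) →
              ⊑-elim (proj₂ w≈ea) (e⁺ a F a∈F) })

    ⋀≤v : ⋀ Open ≤ v
    ⋀≤v = ⊑-intro λ F∈ → extent λ {I} I∈v →
      attribute⁻ I (⊑-elim (⋀-lower Open (attribute-open I , ≤-attribute I∈v)) F∈)

  -- The filter `F` generated from `A` lies in the extent of `⋀ A`, and `⋁ B` lies below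
  -- `attribute I` for the ideal `I` generated from `B`. So the inequality makes `F` and `I` meet,
  -- and a common element is above a finite meet from `A` and below a finite join from `B`.
  compact : Compact
  compact A B A⊆K B⊆O = mk⇔ finite infinite
    where
    -- In the dual lattice `⋀ᶠ` unfolds to `⋁ᶠ`, so the lemmas on meets serve for joins.
    module Lᵒᵖ = CompleteLatticeProperties (dual conceptLattice)

    F : Filter P
    F = generatedFilter P em λ a → ∃[ c ] (c ∈ A × c ≤ e a)

    I : Ideal
    I = generatedFilter Pᵒᵖ em λ a → ∃[ c ] (c ∈ B × e a ≤ c)

    F∈⋀A : F ∈ Extent (⋀ A)
    F∈⋀A = ∈-Extent-⋀ A F λ v v∈A →
      let S , lower , greatest = A⊆K v∈A
          Sᶜ = Lift (lsuc u) ∘ Image poset e S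
      in ⊑-elim (greatest (⋀ Sᶜ) λ x x∈ → ⋀-lower Sᶜ (lift x∈))
           (∈-Extent-⋀ Sᶜ F λ { w (lift (a , a∈S , w≈ea)) →
              ⊑-elim (proj₂ w≈ea) (e⁺ a F (decide⁺ em (Generatedꟳ P _)
                (gen (v , v∈A , lower (e a) (a , a∈S , Eq.refl))))) })

    ⋁B≤I : ⋁ B ≤ attribute I
    ⋁B≤I = ⋁-least B λ v v∈B →
      let S , upper , least = B⊆O v∈B
      in least (attribute I) λ { w (a , a∈S , w≈ea) →
           ≤-respˡ-≈ (Eq.sym w≈ea) (member-≤-attribute (decide⁺ em (Generatedꟳ Pᵒᵖ _)
             (gen (v , v∈B , upper (e a) (a , a∈S , Eq.refl))))) }

    finite : ⋀ A ≤ ⋁ B → ∃[ A₀ ] ∃[ B₀ ] (All A A₀ × All B B₀ × ⋀ᶠ A₀ ≤ ⋁ᶠ B₀)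
    finite ⋀A≤⋁B =
      let c , c∈F , c∈I = attribute⁻ I (⊑-elim (trans ⋀A≤⋁B ⋁B≤I) F∈⋀A)
          A₀ , A₀⊆A , A₀≤c = generated-finitely P conceptLattice e e-mono e-meets A
                               (decide⁻ em (Generatedꟳ P _) c∈F)
          B₀ , B₀⊆B , c≤B₀ = generated-finitely Pᵒᵖ (dual conceptLattice) e e-mono e-joins B
                               (decide⁻ em (Generatedꟳ Pᵒᵖ _) c∈I)
      in A₀ , B₀ , A₀⊆A , B₀⊆B , trans A₀≤c c≤B₀

    infinite : (∃[ A₀ ] ∃[ B₀ ] (All A A₀ × All B B₀ × ⋀ᶠ A₀ ≤ ⋁ᶠ B₀)) → ⋀ A ≤ ⋁ B
    infinite (A₀ , B₀ , A₀⊆A , B₀⊆B , A₀≤B₀) =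
      trans (⋀ᶠ-greatest (All.map (⋀-lower A) A₀⊆A))
        (trans A₀≤B₀ (Lᵒᵖ.⋀ᶠ-greatest (All.map (⋁-upper B) B₀⊆B)))

  canonicalExtension : CanonicalExtension P
  canonicalExtension = record { completion = completion ; dense = dense ; compact = compact }

-- Extensions of maps on the embedded poset.

module _ {u : Level} {X : Set u} (C : Poset u u u) (e : X → Poset.Carrier C) where
  open Poset C

  image-closed : ∀ a → e a ∈ IsClosed C e
  image-closed a = (_≡ a) , (λ { c (_ , ≡-refl , c≈ea) → reflexive (Eq.sym c≈ea) }) ,
                            (λ l l≤ → l≤ (e a) (a , ≡-refl , Eq.refl))

  image-open : ∀ a → e a ∈ IsOpen C e
  image-open a = (_≡ a) , (λ { c (_ , ≡-refl , c≈ea) → reflexive c≈ea }) ,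
                          (λ b ≤b → ≤b (e a) (a , ≡-refl , Eq.refl))

module _ {u : Level} {X Y : Set u}
         (C : Poset u u u) (e : X → Poset.Carrier C)
         (D : CompleteLattice u) (d : Y → CompleteLattice.Carrier D) (f : X → Y)
         (f-resp : ∀ {a b} → Poset._≤_ C (e a) (e b) → Poset._≤_ C (e b) (e a) →
                   CompleteLattice._≈_ D (d (f a)) (d (f b))) where
  private module C = Poset C
  open CompleteLattice D
  open CompleteLatticeProperties D

  -- Every interval around `e a` contains `a`, so no meet in the join exceeds `d (f a)`. The
  -- degenerate interval from `e a` to `e a`, admissible as `e a` is both closed and open, attains
  -- this value.
  σ-extension-image : ∀ a → σ-extension C e D d f (e a) ≈ d (f a)
  σ-extension-image a = antisym
    (⋁-least _ λ { y (p , q , _ , _ , p≤ , ≤q , y≈) → ≤-respˡ-≈ (Eq.sym y≈)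
       (⋀-lower (ImageOfInterval C e D d f p q) (a , lift (p≤ , ≤q) , Eq.refl)) })
    (trans
      (⋀-greatest (ImageOfInterval C e D d f (e a) (e a)) λ { y (b , lift (a≤b , b≤a) , y≈) →
         reflexive (Eq.trans (f-resp a≤b b≤a) (Eq.sym y≈)) })
      (⋁-upper _ (e a , e a , image-closed C e a , image-open C e a , C.refl , C.refl , Eq.refl)))

  π-extension-image : ∀ a → π-extension C e D d f (e a) ≈ d (f a)
  π-extension-image a = antisym
    (trans
      (⋀-lower _ (e a , e a , image-closed C e a , image-open C e a , C.refl , C.refl , Eq.refl))
      (⋁-least (ImageOfInterval C e D d f (e a) (e a)) λ { y (b , lift (a≤b , b≤a) , y≈) →
         reflexive (Eq.trans y≈ (f-resp b≤a a≤b)) }))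
    (⋀-greatest _ λ { y (p , q , _ , _ , p≤ , ≤q , y≈) → ≤-respʳ-≈ (Eq.sym y≈)
       (⋁-upper (ImageOfInterval C e D d f p q) (a , lift (p≤ , ≤q) , Eq.refl)) })

-- Meets of descending chains in a canonical extension.

module _ {u : Level} {P : Poset u u u} (C : CanonicalExtension P) where
  private module P = Poset P
  open CanonicalExtension C
  open CompleteLatticeProperties completeLattice
  open IsOrderMonomorphism e-embedding using (mono; cancel)

  module _ (c : ℕ → P.Carrier) where

    Chain : Pred Carrier (lsuc u)
    Chain x = Lift (lsuc u) (Image poset e (λ a → ∃[ k ] (a ≡ c k)) x)

    ⋀-Chain-lower : ∀ k → ⋀ Chain ≤ e (c k)
    ⋀-Chain-lower k = ⋀-lower Chain (lift (c k , (k , ≡-refl) , Eq.refl))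

    ⋀-Chain-closed : ⋀ Chain ∈ K
    ⋀-Chain-closed = (λ a → ∃[ k ] (a ≡ c k)) ,
      (λ x x∈ → ⋀-lower Chain (lift x∈)) ,
      (λ l l≤ → ⋀-greatest Chain λ { x (lift x∈) → l≤ x x∈ })

    -- By compactness the meet of finitely many terms of the chain is below `e b`; as the chain
    -- descends, a term of large enough index lies below all of them.
    ⋀-Chain-compact : (∀ {j k} → j ≤ⁿ k → c k P.≤ c j) →
                      ∀ {b} → ⋀ Chain ≤ e b → ∃[ k ] (c k P.≤ b)
    ⋀-Chain-compact antitone {b} ⋀≤b =
      let A₀ , B₀ , A₀⊆ , B₀⊆ , A₀≤B₀ = Equivalence.to (compact Chain B Chain⊆K B⊆O)
                                          (trans ⋀≤b (⋁-upper B (lift Eq.refl)))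
          N , ≤A₀ = below-finite A₀⊆
      in N , cancel (trans (⋀ᶠ-greatest ≤A₀) (trans A₀≤B₀
               (CompleteLatticeProperties.⋀ᶠ-greatest (dual completeLattice)
                 (All.map (λ { (lift x≈b) → reflexive x≈b }) B₀⊆))))
      where
      B : Pred Carrier (lsuc u)
      B x = Lift (lsuc u) (x ≈ e b)

      Chain⊆K : Chain ⊆ K
      Chain⊆K (lift (a , _ , x≈ea)) = (_≡ a) ,
        (λ { y (_ , ≡-refl , y≈ea) → reflexive (Eq.trans x≈ea (Eq.sym y≈ea)) }) ,
        (λ l l≤ → ≤-respʳ-≈ (Eq.sym x≈ea) (l≤ (e a) (a , ≡-refl , Eq.refl)))

      B⊆O : B ⊆ O
      B⊆O (lift x≈eb) = (_≡ b) ,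
        (λ { y (_ , ≡-refl , y≈eb) → reflexive (Eq.trans y≈eb (Eq.sym x≈eb)) }) ,
        (λ l ≤l → ≤-respˡ-≈ (Eq.sym x≈eb) (≤l (e b) (b , ≡-refl , Eq.refl)))

      below-finite : ∀ {xs} → All Chain xs → ∃[ N ] All (e (c N) ≤_) xs
      -- An empty list imposes no condition; the index 0 is a default.
      below-finite [] = 0 , []
      below-finite (lift (_ , (k , ≡-refl) , x≈) ∷ xs∈) =
        let N , ≤xs = below-finite xs∈
        in k ⊔ N , ≤-respʳ-≈ (Eq.sym x≈) (mono (antitone (ℕ.m≤m⊔n k N))) ∷
           All.map (trans (mono (antitone (ℕ.m≤n⊔m k N)))) ≤xs

-- Homomorphisms and evaluation of terms.

module _ {u : Level} {S : Signature u} where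

  record IsHomomorphism (A B : Algebra S) (h : Algebra.Carrier A → Algebra.Carrier B) : Set u where
    private
      module A = Algebra A
      module B = Algebra B
    field
      cong : ∀ {x y} → x A.≈ y → h x B.≈ h y
      homo : ∀ o as → h (A.op o as) B.≈ B.op o (h ∘ as)

    eval-homo : ∀ {X} (s : Term S X) ρ → h (eval A s ρ) B.≈ eval B s (h ∘ ρ)
    eval-homo (var x)    ρ = B.refl
    eval-homo (app o ss) ρ = B.trans (homo o _) (B.op-cong o λ i → eval-homo (ss i) ρ)

  module _ (A : Algebra S) where
    open Algebra A

    eval-cong : ∀ {X} (s : Term S X) {ρ ρ′} → (∀ x → ρ x ≈ ρ′ x) → eval A s ρ ≈ eval A s ρ′
    eval-cong (var x)    ρ≈ρ′ = ρ≈ρ′ x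
    eval-cong (app o ss) ρ≈ρ′ = op-cong o λ i → eval-cong (ss i) ρ≈ρ′

    eval-[] : ∀ {X Y} (s : Term S X) (θ : X → Term S Y) ρ →
              eval A (s [ θ ]) ρ ≈ eval A s (λ x → eval A (θ x) ρ)
    eval-[] (var x)    θ ρ = refl
    eval-[] (app o ss) θ ρ = op-cong o λ i → eval-[] (ss i) θ ρ

    Holds : ∀ {X} → (X → Carrier) → Term S X × Term S X → Set u
    Holds ρ (s , t) = eval A s ρ ≈ eval A t ρ

    Holds-cong : ∀ {X} {ρ ρ′ : X → Carrier} → (∀ x → ρ x ≈ ρ′ x) →
                 ∀ {eq} → Holds ρ eq → Holds ρ′ eq
    Holds-cong ρ≈ρ′ {s , t} h =
      trans (sym (eval-cong s ρ≈ρ′)) (trans h (eval-cong t ρ≈ρ′))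

    generated-term : ∀ {k} {g : Vector Carrier k} {a} → Generated A g a →
                     ∃[ s ] (eval A s g ≈ a)
    generated-term (gen i)       = var i , refl
    generated-term (opᵍ o as∈)   =
      app o (proj₁ ∘ generated-term ∘ as∈) , op-cong o (proj₂ ∘ generated-term ∘ as∈)
    generated-term (resp x≈y x∈) =
      let s , s≈x = generated-term x∈ in s , trans s≈x x≈y

    /⟨⟩-homomorphism : ∀ R → IsHomomorphism A (A /⟨ R ⟩) id
    /⟨⟩-homomorphism R = record { cong = reflᶜ ; homo = λ o as → reflᶜ refl }

    proj₁-homomorphism : ∀ {k} (g : Vector Carrier k) → IsHomomorphism (Subalgebra⟨_⟩ A g) A proj₁
    proj₁-homomorphism g = record { cong = id ; homo = λ o as → refl }

-- Equational logic and presentations.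

module _ {u : Level} (V : Variety u) where
  open Variety V

  image-model : ∀ {A B h} → IsHomomorphism A B h →
                (∀ b → ∃[ a ] Algebra._≈_ B (h a) b) → Model A → Model B
  image-model {A} {B} {h} isHom onto A∈V {l} {r} l≋r ρ =
    Holds-cong B (proj₂ ∘ onto ∘ ρ) {l , r} (begin
      eval B l (h ∘ ρ′)  ≈⟨ eval-homo l ρ′ ⟨
      h (eval A l ρ′)    ≈⟨ cong (A∈V l≋r ρ′) ⟩
      h (eval A r ρ′)    ≈⟨ eval-homo r ρ′ ⟩
      eval B r (h ∘ ρ′)  ∎)
    where
    open IsHomomorphism isHom
    open ≈-Reasoning (Algebra.setoid B)
    ρ′ = proj₁ ∘ onto ∘ ρ

  module _ {n : ℕ} where

    soundness : ∀ A → Model A → ∀ {s s′} → Derivable n s s′ → A ⊨ s ≋ s′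
    soundness A A∈V (instanceᵈ {l} {r} l≋r θ) ρ = begin
      eval A (l [ θ ]) ρ              ≈⟨ eval-[] A l θ ρ ⟩
      eval A l (λ x → eval A (θ x) ρ) ≈⟨ A∈V l≋r _ ⟩
      eval A r (λ x → eval A (θ x) ρ) ≈⟨ eval-[] A r θ ρ ⟨
      eval A (r [ θ ]) ρ              ∎
      where open ≈-Reasoning (Algebra.setoid A)
    soundness A A∈V reflᵈ        ρ = Algebra.refl A
    soundness A A∈V (symᵈ d)     ρ = Algebra.sym A (soundness A A∈V d ρ)
    soundness A A∈V (trnᵈ d d′)  ρ = Algebra.trans A (soundness A A∈V d ρ) (soundness A A∈V d′ ρ)
    soundness A A∈V (appᵈ o ds)  ρ = Algebra.op-cong A o λ i → soundness A A∈V (ds i) ρ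

    eval-Free : ∀ {X} (s : Term signature X) ρ → Derivable n (eval (Free n) s ρ) (s [ ρ ])
    eval-Free (var x)    ρ = reflᵈ
    eval-Free (app o ss) ρ = appᵈ o λ i → eval-Free (ss i) ρ

    Free-model : Model (Free n)
    Free-model {l} {r} l≋r ρ =
      trnᵈ (eval-Free l ρ) (trnᵈ (instanceᵈ l≋r ρ) (symᵈ (eval-Free r ρ)))

    []-var : ∀ s → Derivable n (s [ var ]) s
    []-var (var x)    = reflᵈ
    []-var (app o ss) = appᵈ o λ i → []-var (ss i)

    module _ {D : Algebra signature} {h} (isHom : IsHomomorphism (Free n) D h) where
      open IsHomomorphism isHom
      open Algebra D using (_≈_; sym; trans)

      eval-[]-homo : ∀ {X} (s : Term signature X) ρ → eval D s (h ∘ ρ) ≈ h (s [ ρ ])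
      eval-[]-homo s ρ = trans (sym (eval-homo s ρ)) (cong (eval-Free s ρ))

      eval-var-homo : ∀ s → eval D s (h ∘ var) ≈ h s
      eval-var-homo s = trans (eval-[]-homo s var) (cong ([]-var s))

    module _ (R : List (Term signature (Fin n) × Term signature (Fin n))) where
      private Q = Free n /⟨ R ⟩

      presented-homomorphism : IsHomomorphism (Free n) Q id
      presented-homomorphism = /⟨⟩-homomorphism (Free n) R

      presented-model : Model Q
      presented-model =
        image-model presented-homomorphism (λ s → s , Algebra.refl Q) Free-model

      presented-holds⁺ : ∀ s s′ → GeneratedCongruence (Free n) R s s′ → Holds Q var (s , s′)
      presented-holds⁺ s s′ s~s′ = trnᶜ (eval-var-homo presented-homomorphism s)
        (trnᶜ s~s′ (symᶜ (eval-var-homo presented-homomorphism s′)))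

      presented-holds⁻ : ∀ s s′ → Holds Q var (s , s′) → GeneratedCongruence (Free n) R s s′
      presented-holds⁻ s s′ h = trnᶜ (symᶜ (eval-var-homo presented-homomorphism s))
        (trnᶜ h (eval-var-homo presented-homomorphism s′))

      relations-hold : All (Holds Q var) R
      relations-hold = All.tabulate (presented-holds⁺ _ _ ∘ base)

      -- Von Dyck's theorem, by induction on the generation of the congruence; it stands in for the
      -- induced homomorphism from the quotient to `A`.
      presented-universal : ∀ A → Model A → ∀ {ρ} → All (Holds A ρ) R →
        ∀ {s s′} → GeneratedCongruence (Free n) R s s′ → Holds A ρ (s , s′)
      presented-universal A A∈V {ρ} R-holds = go
        where
        open Algebra A
        go : ∀ {s s′} → GeneratedCongruence (Free n) R s s′ → Holds A ρ (s , s′)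
        go (base s,s′∈R)  = All.lookup R-holds s,s′∈R
        go (reflᶜ d)      = soundness A A∈V d ρ
        go (symᶜ c)       = sym (go c)
        go (trnᶜ c c′)    = trans (go c) (go c′)
        go (opᶜ o cs)     = op-cong o λ i → go (cs i)

  -- A presentation on other generators is rewritten on g: in the proof, w
  -- expresses those generators by g and x expresses g by them.
  presentation-on-generators : ∀ {B m} (g : Vector (Algebra.Carrier B) m) →
    FinitelyPresented (Subalgebra⟨_⟩ B g) →
    ∃[ E ] (All (Holds B g) E ×
      (∀ A → Model A → ∀ {ρ} → All (Holds A ρ) E → ∀ eq → Holds B g eq → Holds A ρ eq))
  presentation-on-generators {B} {m} g (n , R , iso) =
    E , Allₚ.++⁺ (Allₚ.map⁺ (All.tabulate λ {(l , r)} lr∈R →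
                   B.trans (recover (eval S l pre) l (to-eval l))
                     (B.sym (recover (eval S l pre) r (trnᶜ (to-eval l) (base lr∈R))))))
                 (Allₚ.tabulate⁺ λ j → recover (g j , gen j) (x j) Q.refl) ,
    λ A A∈V {ρ} E-holds (s , s′) → transfer A A∈V E-holds s s′
    where
    S = Subalgebra⟨_⟩ B g
    Q = Free n /⟨ R ⟩
    module B = Algebra B
    module S = Algebra S
    module Q = Algebra Q
    open _≅_ iso
    to-hom : IsHomomorphism S Q to
    to-hom = record { cong = to-cong ; homo = to-op }

    onto : ∀ i → ∃[ a ] (to a Q.≈ var i)
    onto i = let a , h = proj₂ bijective (var i) in a , h {a} (S.refl {a})

    pre : Fin n → S.Carrier
    pre = proj₁ ∘ onto

    w : Fin n → Term signature (Fin m)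
    w i = proj₁ (generated-term B (proj₂ (pre i)))

    -- Elements of `Q` are themselves terms, so the image of a generator under the isomorphism can
    -- be substituted directly.
    x : Fin m → Term signature (Fin n)
    x j = to (g j , gen j)

    -- A Tietze transformation: the relations of `R` rewritten by `w`, and the equations by which
    -- expressing `g j` through the old generators and back returns `g j`.
    E : List (Term signature (Fin m) × Term signature (Fin m))
    E = map (λ (l , r) → l [ w ] , r [ w ]) R ++ tabulate (λ j → x j [ w ] , var j)

    to-eval : ∀ s → to (eval S s pre) Q.≈ s
    to-eval s = begin
      to (eval S s pre)    ≈⟨ IsHomomorphism.eval-homo to-hom s pre ⟩
      eval Q s (to ∘ pre)  ≈⟨ eval-cong Q s (proj₂ ∘ onto) ⟩
      eval Q s var         ≈⟨ eval-var-homo (presented-homomorphism R) s ⟩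
      s                    ∎
      where open ≈-Reasoning Q.setoid

    recover : ∀ a s → to a Q.≈ s → eval B (s [ w ]) g B.≈ proj₁ a
    recover a s to-a≈s = begin
      eval B (s [ w ]) g                 ≈⟨ eval-[] B s w g ⟩
      eval B s (λ i → eval B (w i) g)    ≈⟨ eval-cong B s (proj₂ ∘ generated-term B ∘ proj₂ ∘ pre) ⟩
      eval B s (proj₁ ∘ pre)             ≈⟨ IsHomomorphism.eval-homo (proj₁-homomorphism B g) s pre ⟨
      proj₁ (eval S s pre)               ≈⟨ proj₁ bijective (Q.trans (to-eval s) (Q.sym to-a≈s)) ⟩
      proj₁ a                            ∎
      where open ≈-Reasoning B.setoid

    transfer : ∀ A → Model A → ∀ {ρ} → All (Holds A ρ) E →
               ∀ s s′ → Holds B g (s , s′) → Holds A ρ (s , s′)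
    transfer A A∈V {ρ} E-holds s s′ s≈s′ = begin
      eval A s ρ            ≈⟨ through s ⟨
      eval A (s [ x ]) ρ′   ≈⟨ presented-universal R A A∈V R-holds s[x]≈s′[x] ⟩
      eval A (s′ [ x ]) ρ′  ≈⟨ through s′ ⟩
      eval A s′ ρ           ∎
      where
      module A = Algebra A
      open ≈-Reasoning A.setoid
      -- The first part of `E` makes `ρ′` satisfy `R`; the second lets every term be evaluated
      -- through `ρ′`.
      ρ′ : Fin n → A.Carrier
      ρ′ i = eval A (w i) ρ

      R-holds : All (Holds A ρ′) R
      R-holds = All.map
        (λ {(l , r)} h → A.trans (A.sym (eval-[] A l w ρ)) (A.trans h (eval-[] A r w ρ)))
        (Allₚ.map⁻ (Allₚ.++⁻ˡ _ E-holds))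

      through : ∀ v → eval A (v [ x ]) ρ′ A.≈ eval A v ρ
      through v = A.trans (eval-[] A v x ρ′) (eval-cong A v λ j →
        A.trans (A.sym (eval-[] A (x j) w ρ)) (Allₚ.tabulate⁻ (Allₚ.++⁻ʳ (map _ R) E-holds) j))

      generators : Fin m → S.Carrier
      generators j = g j , gen j

      to-generators : ∀ v → to (eval S v generators) Q.≈ v [ x ]
      to-generators v = Q.trans (IsHomomorphism.eval-homo to-hom v generators)
                                (eval-[]-homo (presented-homomorphism R) v x)

      in-B : ∀ v → proj₁ (eval S v generators) B.≈ eval B v g
      in-B v = IsHomomorphism.eval-homo (proj₁-homomorphism B g) v generators

      s[x]≈s′[x] : s [ x ] Q.≈ s′ [ x ]
      s[x]≈s′[x] = Q.trans (Q.sym (to-generators s)) (Q.trans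
        (to-cong (B.trans (in-B s) (B.trans s≈s′ (B.sym (in-B s′)))))
        (to-generators s′))

upper-bound : ∀ {n} (f : Fin n → ℕ) → ∃[ N ] (∀ i → f i ≤ⁿ N)
upper-bound {zero}  f = 0 , λ ()
upper-bound {suc n} f =
  let N , f≤N = upper-bound (f ∘ suc)
  in f zero ⊔ N , λ { zero    → ℕ.m≤m⊔n (f zero) N
                    ; (suc i) → ℕ.≤-trans (f≤N i) (ℕ.m≤n⊔m (f zero) N) }

-- The canonical embedding, and inequalities as equations.

module _ {u : Level} (V : SemilatticeOrderedVariety u) where
  open SemilatticeOrderedVariety V

  module _ (A : Algebra signature) (A∈V : Model A)
           (C : CanonicalExtension (reduct A A∈V)) where
    private
      module A = Algebra A
      module C = CanonicalExtension C
      Aσ = canonicalAlgebra A A∈V C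
      open IsOrderMonomorphism C.e-embedding using (cong; cancel)

    -- On the image of the embedding the σ- and the π-extension both agree with the operation
    -- itself.
    embedding-homomorphism : IsHomomorphism A Aσ C.e
    embedding-homomorphism = record
      { cong = cong
      ; homo = λ o as → C.Eq.sym (extend-image (extensionKind o) o as)
      }
      where
      op-resp : ∀ o {as bs : Vector A.Carrier (arity o)} →
                (∀ i → C.e (as i) C.≤ C.e (bs i)) → (∀ i → C.e (bs i) C.≤ C.e (as i)) →
                C.e (A.op o as) C.≈ C.e (A.op o bs)
      op-resp o as≤bs bs≤as = cong (A.op-cong o λ i →
        Poset.antisym (reduct A A∈V) (cancel (as≤bs i)) (cancel (bs≤as i)))

      extend-image : ∀ k o as → extend A A∈V C k o (C.e ∘ as) C.≈ C.e (A.op o as)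
      extend-image σ o = σ-extension-image (C.poset ^ᴾ arity o) (C.e ∘_) C.completeLattice C.e
                           (A.op o) (λ {as} {bs} → op-resp o {as} {bs})
      extend-image π o = π-extension-image (C.poset ^ᴾ arity o) (C.e ∘_) C.completeLattice C.e
                           (A.op o) (λ {as} {bs} → op-resp o {as} {bs})

  -- Writing the order as an equation in the semilattice term lets inequalities serve as relations
  -- of a presentation. The sides are arranged as in `Order`.
  inequality : ∀ {X} → SemilatticeKind → Term signature X → Term signature X →
               Term signature X × Term signature X
  inequality meet s s′ = s , semilatticeTerm [ s Vector.∷ s′ Vector.∷ Vector.[] ]
  inequality join s s′ = s′ , semilatticeTerm [ s′ Vector.∷ s Vector.∷ Vector.[] ]

  infix 6 _≼_
  _≼_ : ∀ {X} → Term signature X → Term signature X → Term signature X × Term signature X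
  _≼_ = inequality semilatticeKind

  module _ (A : Algebra signature) {X : Set} (ρ : X → Algebra.Carrier A) where
    open Algebra A

    eval-semilatticeTerm : ∀ s s′ →
      eval A (semilatticeTerm [ s Vector.∷ s′ Vector.∷ Vector.[] ]) ρ ≈
      binary A semilatticeTerm (eval A s ρ) (eval A s′ ρ)
    eval-semilatticeTerm s s′ = trans (eval-[] A semilatticeTerm _ ρ)
      (eval-cong A semilatticeTerm λ { zero → refl ; (suc zero) → refl })

    holds-inequality⁺ : ∀ k {s s′} → Order k A (eval A s ρ) (eval A s′ ρ) →
                        Holds A ρ (inequality k s s′)
    holds-inequality⁺ meet {s} {s′} s≤s′ = trans s≤s′ (sym (eval-semilatticeTerm s s′))
    holds-inequality⁺ join {s} {s′} s≤s′ = trans s≤s′ (sym (eval-semilatticeTerm s′ s))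

    holds-inequality⁻ : ∀ k {s s′} → Holds A ρ (inequality k s s′) →
                        Order k A (eval A s ρ) (eval A s′ ρ)
    holds-inequality⁻ meet {s} {s′} h = trans h (eval-semilatticeTerm s s′)
    holds-inequality⁻ join {s} {s′} h = trans h (eval-semilatticeTerm s′ s)

  module _ (A : Algebra signature) (A∈V : Model A) {X : Set} {ρ : X → Algebra.Carrier A} where
    open Poset (reduct A A∈V)

    ≼⁺ : ∀ {s s′} → eval A s ρ ≤ eval A s′ ρ → Holds A ρ (s ≼ s′)
    ≼⁺ = holds-inequality⁺ A ρ semilatticeKind

    ≼⁻ : ∀ {s s′} → Holds A ρ (s ≼ s′) → eval A s ρ ≤ eval A s′ ρ
    ≼⁻ = holds-inequality⁻ A ρ semilatticeKind

  -- Iterates of the term and their limit in the canonical extension.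

  module _ (t : Term signature (Fin 1)) where

    iterate : ∀ {X} → ℕ → Term signature X → Term signature X
    iterate k s = (t ^ k) [ (λ _ → s) ]

    module _ (A : Algebra signature) where
      open Algebra A

      eval-unary : ∀ {X} (s : Term signature (Fin 1)) (r : Term signature X) ρ →
                   eval A (s [ (λ _ → r) ]) ρ ≈ unary A s (eval A r ρ)
      eval-unary s r ρ = trans (eval-[] A s _ ρ) (eval-cong A s λ { zero → refl })

      unary-^-suc : ∀ k a → unary A (t ^ suc k) a ≈ unary A t (unary A (t ^ k) a)
      unary-^-suc k a = eval-unary t (t ^ k) _

    module _ (preserving : OrderPreserving t) (decreasing : Decreasing t)
             (A : Algebra signature) (A∈V : Model A) where
      open Poset (reduct A A∈V)

      ^-suc-≤ : ∀ k a → unary A (t ^ suc k) a ≤ unary A (t ^ k) a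
      ^-suc-≤ k a = ≤-respˡ-≈ (Eq.sym (unary-^-suc A k a)) (decreasing A A∈V _)

      ^-antitone : ∀ {j k} → j ≤ⁿ k → ∀ a → unary A (t ^ k) a ≤ unary A (t ^ j) a
      ^-antitone {j} j≤k a = go (ℕ.≤⇒≤′ j≤k)
        where
        go : ∀ {k} → j ≤′ k → unary A (t ^ k) a ≤ unary A (t ^ j) a
        go ≤′-refl = refl
        go {suc k} (≤′-step j≤k) = trans (^-suc-≤ k a) (go j≤k)

      -- Induction on `k` with `c ≤ t(c) ≤ t(tᵏ(a))` by order preservation. It lets two inequalities
      -- on `c` replace infinitely many bounds.
      postfixpoint-≤ : ∀ {a c} → c ≤ a → c ≤ unary A t c → ∀ k → c ≤ unary A (t ^ k) a
      postfixpoint-≤ c≤a c≤tc zero = c≤a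
      postfixpoint-≤ {a} c≤a c≤tc (suc k) = trans c≤tc
        (≤-respʳ-≈ (Eq.sym (unary-^-suc A k a))
          (preserving A A∈V _ _ (postfixpoint-≤ c≤a c≤tc k)))

      module _ (expanding : Expanding t) (C : CanonicalExtension (reduct A A∈V)) (a : Carrier) where
        private module C = CanonicalExtension C
        open CompleteLatticeProperties C.completeLattice

        limit : C.Carrier
        limit = C.⋀ (Chain C λ k → unary A (t ^ k) a)

        -- In the join defining the σ-extension, the interval from `limit` to `e a` suffices: for
        -- `b` in it, compactness gives `tᵏ(a) ≤ b` for some `k`, so `limit ≤ tᵏ⁺¹(a) ≤ t(b)`.
        limit-postfixpoint : limit C.≤ unary (canonicalAlgebra A A∈V C) t limit
        limit-postfixpoint = C.trans
          (C.trans
            (⋀-greatest (ImageOfInterval C.poset C.e C.completeLattice C.e (unary A t) limit (C.e a))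
              λ { x (b , lift (limit≤b , _) , x≈) → C.≤-respʳ-≈ (C.Eq.sym x≈)
                    (let k , tᵏa≤b = ⋀-Chain-compact C _ (λ j≤k → ^-antitone j≤k a) limit≤b
                     in C.trans (⋀-Chain-lower C _ (suc k))
                          (mono (≤-respˡ-≈ (Eq.sym (unary-^-suc A k a))
                                  (preserving A A∈V _ _ tᵏa≤b)))) })
            -- The interval is admissible: `limit` is closed as a meet of embedded elements, `e a`
            -- is open, and the term of index 0 of the chain is `a` itself.
            (⋁-upper _ (limit , C.e a , ⋀-Chain-closed C _ , image-open C.poset C.e a ,
                        C.refl , ⋀-Chain-lower C _ 0 , C.Eq.refl)))
          (expanding A A∈V C limit)
          where open IsOrderMonomorphism C.e-embedding using (mono)

        below-limit : ∀ {b} → (∀ k → b ≤ unary A (t ^ k) a) → C.e b C.≤ limit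
        below-limit b≤ = ⋀-greatest (Chain C _) λ { x (lift (_ , (k , ≡-refl) , x≈)) →
          C.≤-respʳ-≈ (C.Eq.sym x≈) (IsOrderMonomorphism.mono C.e-embedding (b≤ k)) }

  -- The interpolated algebra and the algebras presented by one bound.

  module _ (t : Term signature (Fin 1)) where

    Between : List (Term signature (Fin 3) × Term signature (Fin 3))
    Between = y ≼ z ∷ z ≼ x ∷ z ≼ t [ (λ _ → z) ] ∷ []
      where
      x = var zero
      y = var (suc zero)
      z = var (suc (suc zero))

    Interpolated : Algebra signature
    Interpolated = Free 3 /⟨ Between ⟩

    Interpolated-model : Model Interpolated
    Interpolated-model = presented-model variety Between

    ends : Vector (Term signature (Fin 3)) 2
    ends = var zero Vector.∷ var (suc zero) Vector.∷ Vector.[]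

    Interpolated-presented : FinitelyPresented Interpolated
    Interpolated-presented = 3 , Between , record
      { to = id ; to-cong = id ; to-op = λ o as → reflᶜ reflᵈ ; bijective = id , λ s → s , id }

    module _ (A : Algebra signature) (A∈V : Model A) (ρ : Fin 3 → Algebra.Carrier A) where
      open Poset (reduct A A∈V)

      Between-holds⁺ : ρ (suc zero) ≤ ρ (suc (suc zero)) → ρ (suc (suc zero)) ≤ ρ zero →
                       ρ (suc (suc zero)) ≤ unary A t (ρ (suc (suc zero))) →
                       All (Holds A ρ) Between
      Between-holds⁺ y≤z z≤x z≤tz =
        ≼⁺ A A∈V y≤z ∷ ≼⁺ A A∈V z≤x ∷
        ≼⁺ A A∈V (≤-respʳ-≈ (Eq.sym (eval-unary t A t _ ρ)) z≤tz) ∷ []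

    bound : ℕ → Term signature (Fin 2) × Term signature (Fin 2)
    bound k = var (suc zero) ≼ iterate t k (var zero)

    module _ (A : Algebra signature) (A∈V : Model A) (ρ : Fin 2 → Algebra.Carrier A) where
      open Poset (reduct A A∈V)

      bound⁺ : ∀ k → ρ (suc zero) ≤ unary A (t ^ k) (ρ zero) →
               Holds A ρ (bound k)
      bound⁺ k y≤tᵏx = ≼⁺ A A∈V (≤-respʳ-≈ (Eq.sym (eval-unary t A (t ^ k) _ ρ)) y≤tᵏx)

      bound⁻ : ∀ k → Holds A ρ (bound k) →
               ρ (suc zero) ≤ unary A (t ^ k) (ρ zero)
      bound⁻ k h = ≤-respʳ-≈ (eval-unary t A (t ^ k) _ ρ) (≼⁻ A A∈V h)

    Bounded : ℕ → Algebra signature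
    Bounded k = Free 2 /⟨ bound k ∷ [] ⟩

    Bounded-model : ∀ k → Model (Bounded k)
    Bounded-model k = presented-model variety (bound k ∷ [])

    Bounded-≤ : ∀ k → Poset._≤_ (reduct (Bounded k) (Bounded-model k))
                        (var (suc zero)) (unary (Bounded k) (t ^ k) (var zero))
    Bounded-≤ k = bound⁻ (Bounded k) (Bounded-model k) var k
                    (All.head (relations-hold variety (bound k ∷ [])))

    module _ (preserving : OrderPreserving t) (decreasing : Decreasing t) where

      -- The iterates decrease, so the relation at stage `k` implies the one at stage `j`, and the
      -- congruences grow with the stage.
      Bounded-antitone : ∀ {j k} → j ≤ⁿ k → ∀ {s s′} →
                         GeneratedCongruence (Free 2) (bound j ∷ []) s s′ →
                         GeneratedCongruence (Free 2) (bound k ∷ []) s s′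
      Bounded-antitone {j} {k} j≤k = presented-holds⁻ variety (bound k ∷ []) _ _ ∘
        presented-universal variety (bound j ∷ []) (Bounded k) (Bounded-model k)
          (bound⁺ (Bounded k) (Bounded-model k) var j
            (trans (Bounded-≤ k)
              (^-antitone t preserving decreasing (Bounded k) (Bounded-model k) j≤k _)) ∷ [])
        where open Poset (reduct (Bounded k) (Bounded-model k)) using (trans)

      -- The direct limit of the `Bounded k`, where all bounds hold at once. Its congruence is the
      -- union over the stages, so each of its equations appears at a finite stage.
      Boundedω : Algebra signature
      Boundedω = record
        { setoid = record
          { Carrier = Term signature (Fin 2)
          ; _≈_ = λ s s′ → ∃[ k ] GeneratedCongruence (Free 2) (bound k ∷ []) s s′
          ; isEquivalence = record
            { refl  = 0 , reflᶜ reflᵈ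
            ; sym   = λ (k , c) → k , symᶜ c
            ; trans = λ (j , c) (k , c′) → j ⊔ k ,
                trnᶜ (Bounded-antitone (ℕ.m≤m⊔n j k) c) (Bounded-antitone (ℕ.m≤n⊔m j k) c′)
            }
          }
        ; op = app
        -- Arities are finite, so the arguments are congruent at a common stage.
        ; op-cong = λ o cs → let N , ≤N = upper-bound (proj₁ ∘ cs)
                             in N , opᶜ o λ i → Bounded-antitone (≤N i) (proj₂ (cs i))
        }

      Boundedω-homomorphism : IsHomomorphism (Free 2) Boundedω id
      Boundedω-homomorphism = record
        { cong = λ d → 0 , reflᶜ d ; homo = λ o as → 0 , reflᶜ reflᵈ }

      Boundedω-model : Model Boundedω
      Boundedω-model = image-model variety Boundedω-homomorphism
        (λ s → s , Algebra.refl Boundedω) (Free-model variety)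

      Bounded-holds⇒Boundedω : ∀ k eq → Holds (Bounded k) var eq → Holds Boundedω var eq
      Bounded-holds⇒Boundedω k (s , s′) h = Boundedω.trans
        (eval-var-homo variety Boundedω-homomorphism s)
        (Boundedω.trans (k , presented-holds⁻ variety (bound k ∷ []) s s′ h)
          (Boundedω.sym (eval-var-homo variety Boundedω-homomorphism s′)))
        where module Boundedω = Algebra Boundedω

      -- An equation that holds at some stage persists at all later ones, so the maximum of the
      -- stages serves a finite list.
      Boundedω-holds⇒Bounded : ∀ {E} → All (Holds Boundedω var) E →
                               ∃[ k ] All (Holds (Bounded k) var) E
      Boundedω-holds⇒Bounded [] = 0 , []
      Boundedω-holds⇒Bounded {(s , s′) ∷ _} (h ∷ hs) =
        let module Boundedω = Algebra Boundedω
            j , s~s′ = Boundedω.trans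
              (Boundedω.sym (eval-var-homo variety Boundedω-homomorphism s))
              (Boundedω.trans h (eval-var-homo variety Boundedω-homomorphism s′))
            k , hs′ = Boundedω-holds⇒Bounded hs
        in j ⊔ k , presented-holds⁺ variety (bound (j ⊔ k) ∷ []) s s′
             (Bounded-antitone (ℕ.m≤m⊔n j k) s~s′) ∷
             All.map (λ {(v , v′)} h → presented-holds⁺ variety (bound (j ⊔ k) ∷ []) v v′
               (Bounded-antitone (ℕ.m≤n⊔m j k)
                 (presented-holds⁻ variety (bound k ∷ []) v v′ h))) hs′

      Boundedω-≤ : ∀ k → Poset._≤_ (reduct Boundedω Boundedω-model)
                           (var (suc zero)) (unary Boundedω (t ^ k) (var zero))
      Boundedω-≤ k = bound⁻ Boundedω Boundedω-model var k
        (Bounded-holds⇒Boundedω k (bound k) (All.head (relations-hold variety (bound k ∷ []))))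

      -- The interpolant `z` is a postfixed point below `x`, hence below every iterate, and `y ≤ z`.
      Interpolated-bound : ∀ k →
        Holds Interpolated ends (bound k)
      Interpolated-bound k = bound⁺ Interpolated Interpolated-model ends k
        (trans y≤z (postfixpoint-≤ t preserving decreasing Interpolated Interpolated-model
                      z≤x (≤-respʳ-≈ (eval-unary t Interpolated t _ var) z≤tz) k))
        where
        open Poset (reduct Interpolated Interpolated-model)
        relations = relations-hold variety Between
        y≤z = ≼⁻ Interpolated Interpolated-model {ρ = var} (All.head relations)
        z≤x = ≼⁻ Interpolated Interpolated-model {ρ = var} (All.head (All.tail relations))
        z≤tz = ≼⁻ Interpolated Interpolated-model {ρ = var} (All.head (All.tail (All.tail relations)))

      module _ (em : ExcludedMiddle (lsuc u)) (closed : ClosedUnderCanonicalExtensions)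
               (expanding : Expanding t) where

        -- With `limit` as the third value, the embedded valuation satisfies `Between` in the
        -- canonical extension. The equation thus holds there, and the injective homomorphism `e`
        -- reflects it into `A`.
        Interpolated-transfer : ∀ A (A∈V : Model A) (ρ : Fin 2 → Algebra.Carrier A) →
          (∀ k → Poset._≤_ (reduct A A∈V) (ρ (suc zero)) (unary A (t ^ k) (ρ zero))) →
          ∀ eq → Holds Interpolated ends eq → Holds A ρ eq
        Interpolated-transfer A A∈V ρ bounds (s , s′) h = injective (begin
          C.e (eval A s ρ)            ≈⟨ through s ⟩
          eval Aσ (s [ ends ]) ρσ     ≈⟨ presented-universal variety Between Aσ Aσ∈V {ρσ}
                                           (Between-holds⁺ Aσ Aσ∈V ρσ y≤z z≤x z≤tz)
                                           s[]≈s′[] ⟩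
          eval Aσ (s′ [ ends ]) ρσ    ≈⟨ through s′ ⟨
          C.e (eval A s′ ρ)           ∎)
          where
          C = CanonicalExtensionOf.canonicalExtension em (reduct A A∈V)
          module C = CanonicalExtension C
          open IsOrderMonomorphism C.e-embedding using (injective)
          open IsHomomorphism (embedding-homomorphism A A∈V C) using (eval-homo)
          Aσ = canonicalAlgebra A A∈V C
          Aσ∈V : Model Aσ
          Aσ∈V = proj₁ (closed A A∈V C)
          -- `Between` speaks of the order given by the semilattice term; closure under canonical
          -- extensions identifies it with the lattice order of `C`.
          to-reduct = λ {x} {y} → Equivalence.to (proj₂ (closed A A∈V C) x y)
          open ≈-Reasoning (Algebra.setoid Aσ)

          z : C.Carrier
          z = limit t preserving decreasing A A∈V expanding C (ρ zero)

          ρσ : Fin 3 → C.Carrier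
          ρσ = C.e (ρ zero) Vector.∷ C.e (ρ (suc zero)) Vector.∷ z Vector.∷ Vector.[]

          y≤z = to-reduct (below-limit t preserving decreasing A A∈V expanding C (ρ zero) bounds)
          z≤x = to-reduct (⋀-Chain-lower C (λ k → unary A (t ^ k) (ρ zero)) 0)
          z≤tz = to-reduct (limit-postfixpoint t preserving decreasing A A∈V expanding C (ρ zero))

          through : ∀ v → C.e (eval A v ρ) C.≈ eval Aσ (v [ ends ]) ρσ
          through v = begin
            C.e (eval A v ρ)                      ≈⟨ eval-homo v ρ ⟩
            eval Aσ v (C.e ∘ ρ)                   ≈⟨ eval-cong Aσ v (λ { zero       → C.Eq.refl
                                                                       ; (suc zero) → C.Eq.refl }) ⟩
            eval Aσ v (λ j → eval Aσ (ends j) ρσ) ≈⟨ eval-[] Aσ v ends ρσ ⟨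
            eval Aσ (v [ ends ]) ρσ               ∎

          s[]≈s′[] : GeneratedCongruence (Free 3) Between (s [ ends ]) (s′ [ ends ])
          s[]≈s′[] = trnᶜ (symᶜ (eval-[]-homo variety isHom s ends))
                       (trnᶜ h (eval-[]-homo variety isHom s′ ends))
            where isHom = presented-homomorphism variety Between

-- From coherence to potency.

theorem5p1 : ∀ {u : Level} → ExcludedMiddle (lsuc u) →
    (V : SemilatticeOrderedVariety u) →
    let open SemilatticeOrderedVariety V in
    HasConstant →
    Coherent →
    ClosedUnderCanonicalExtensions →
    (t : Term signature (Fin 1)) →
    Expanding t →
    OrderPreserving t →
    Decreasing t →
    ∃[ n ] Satisfies (t ^ suc n) (t ^ n)
theorem5p1 em V _ coherent closed t expanding preserving decreasing =
  n , λ A A∈V ρ → Holds-cong A {ρ = ρ zero Vector.∷ Vector.[]} (λ { zero → Algebra.refl A })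
    {t ^ suc n , t ^ n} (potent A A∈V (ρ zero))
  where
  open SemilatticeOrderedVariety V

  presentation = presentation-on-generators variety (ends V t)
    (coherent (Interpolated V t) (Interpolated-model V t) (Interpolated-presented V t) (ends V t))

  -- The generators of `Boundedω` satisfy every bound, so the finite list given by coherence
  -- transfers to them, and then holds at a finite stage, whose index is the exponent sought.
  stage = Boundedω-holds⇒Bounded V t preserving decreasing
    (All.map (λ {eq} → Interpolated-transfer V t preserving decreasing em closed expanding
        (Boundedω V t preserving decreasing) (Boundedω-model V t preserving decreasing) var
        (Boundedω-≤ V t preserving decreasing) eq)
      (proj₁ (proj₂ presentation)))

  n = proj₁ stage

  -- The bound at `suc n` holds for `ends`, so it follows from the finite list and therefore holds
  -- in `Bounded n`.
  n-bound = presented-holds⁻ variety (bound V t n ∷ [])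
    (proj₁ (bound V t (suc n))) (proj₂ (bound V t (suc n)))
    (proj₂ (proj₂ presentation) (Bounded V t n) (Bounded-model V t n) (proj₂ stage)
      (bound V t (suc n))
      (Interpolated-bound V t preserving decreasing (suc n)))

  potent : ∀ A → Model A → ∀ a → Algebra._≈_ A (unary A (t ^ suc n) a) (unary A (t ^ n) a)
  potent A A∈V a = antisym (^-suc-≤ V t preserving decreasing A A∈V n a)
    (bound⁻ V t A A∈V ρ (suc n) (presented-universal variety (bound V t n ∷ []) A A∈V {ρ}
      (bound⁺ V t A A∈V ρ n refl ∷ []) n-bound))
    where
    open Poset (reduct A A∈V)
    -- With `tⁿ(a)` as the second value the bound at `n` holds by reflexivity, and the one it
    -- entails reads `tⁿ(a) ≤ tⁿ⁺¹(a)`.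
    ρ : Fin 2 → Algebra.Carrier A
    ρ = a Vector.∷ unary A (t ^ n) a Vector.∷ Vector.[]
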